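{- Let $(F_n)_{n\ge 0}$ be the Fibonacci sequence. The solutions of the Diophantine equation $$F_{n_1}+F_{n_2}+F_{n_3}+F_{n_4}+F_{n_5}=2^a$$ in positive integers $n_1,n_2,n_3,n_4,n_5,a$ with $n_1\ge n_2\ge n_3\ge n_4\ge n_5$ are exactly those for which $(n_5,n_4,n_3,n_2,n_1)$ is one of the following $106$ tuples (with $a$ then determined by the equation): (1,1,1,3,4), (1,1,1,5,6), (1,1,1,6,8), (1,1,1,9,16), (1,1,2,3,4), (1,1,2,5,6), (1,1,2,6,8), (1,1,2,9,16), (1,1,3,3,3), (1,1,3,5,10), (1,1,4,4,6), (1,1,4,9,11), (1,1,6,7,13), (1,1,8,11,12), (1,1,10,10,12), (1,2,2,3,4), (1,2,2,5,6), (1,2,2,6,8), (1,2,2,9,16), (1,2,3,3,3), (1,2,3,5,10), (1,2,4,4,6), (1,2,4,9,11), (1,2,6,7,13), (1,2,8,11,12), (1,2,10,10,12), (1,3,3,4,6), (1,3,3,9,11), (1,3,4,4,10), (1,3,4,5,5), (1,3,4,5,8), (1,3,4,7,7), (1,3,6,6,7), (1,3,7,8,16), (1,3,9,14,15), (1,4,5,8,9), (1,4,7,7,9), (1,5,5,6,7), (1,6,6,7,9), (1,6,7,8,8), (2,2,2,3,4), (2,2,2,5,6), (2,2,2,6,8), (2,2,2,9,16), (2,2,3,3,3), (2,2,3,5,10), (2,2,4,4,6), (2,2,4,9,11), (2,2,6,7,13), (2,2,8,11,12), (2,2,10,10,12), (2,3,3,4,6), (2,3,3,9,11), (2,3,4,4,10),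 (2,3,4,5,5), (2,3,4,5,8), (2,3,4,7,7), (2,3,6,6,7), (2,3,7,8,16), (2,3,9,14,15), (2,4,5,8,9), (2,4,7,7,9), (2,5,5,6,7), (2,6,6,7,9), (2,6,7,8,8), (3,3,3,3,6), (3,3,3,4,10), (3,3,3,5,5), (3,3,3,5,8), (3,3,3,7,7), (3,3,5,8,9), (3,3,7,7,9), (3,4,4,4,5), (3,4,4,4,8), (3,4,5,7,13), (3,4,7,8,11), (3,4,7,10,10), (3,4,9,9,10), (3,5,6,6,13), (3,6,6,8,11), (3,6,6,10,10), (3,6,7,11,12), (3,8,9,10,12), (3,8,10,11,11), (3,10,10,10,11), (4,4,4,8,9), (4,4,5,6,7), (4,5,6,6,6), (4,5,6,8,16), (4,6,7,7,16), (4,7,8,14,15), (4,9,12,13,15), (4,9,13,14,14), (4,11,11,13,15), (5,5,5,6,13), (5,5,6,8,11), (5,5,6,10,10), (5,5,7,11,12), (5,6,7,7,11), (5,7,8,9,10), (5,8,9,9,9), (6,6,6,7,16), (6,6,8,14,15), (6,10,14,16,20), (7,7,7,9,10), (7,7,9,9,9).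
   Context: The Fibonacci sequence is defined by $F_0=0$, $F_1=1$ and $F_{n+2}=F_{n+1}+F_n$ for $n\ge 0$. Each tuple above lists the indices in increasing order $(n_5,n_4,n_3,n_2,n_1)$. -}

module Defs where

open import Data.Nat using (ℕ; zero; suc; _+_)
open import Data.List using (List; []; _∷_)
open import Data.Product using (_×_; _,_)

fib : ℕ → ℕ
fib zero = 0
fib (suc zero) = 1
fib (suc (suc n)) = fib (suc n) + fib n

-- A 5-tuple (n5 , n4 , n3 , n2 , n1), listed in increasing order as in the paper
Tuple5 : Set
Tuple5 = ℕ × ℕ × ℕ × ℕ × ℕ

solutions : List Tuple5
solutions =
    (1 , 1 , 1 , 3 , 4) ∷
    (1 , 1 , 1 , 5 , 6) ∷
    (1 , 1 , 1 , 6 , 8) ∷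
    (1 , 1 , 1 , 9 , 16) ∷
    (1 , 1 , 2 , 3 , 4) ∷
    (1 , 1 , 2 , 5 , 6) ∷
    (1 , 1 , 2 , 6 , 8) ∷
    (1 , 1 , 2 , 9 , 16) ∷
    (1 , 1 , 3 , 3 , 3) ∷
    (1 , 1 , 3 , 5 , 10) ∷
    (1 , 1 , 4 , 4 , 6) ∷
    (1 , 1 , 4 , 9 , 11) ∷
    (1 , 1 , 6 , 7 , 13) ∷
    (1 , 1 , 8 , 11 , 12) ∷
    (1 , 1 , 10 , 10 , 12) ∷
    (1 , 2 , 2 , 3 , 4) ∷
    (1 , 2 , 2 , 5 , 6) ∷
    (1 , 2 , 2 , 6 , 8) ∷
    (1 , 2 , 2 , 9 , 16) ∷
    (1 , 2 , 3 , 3 , 3) ∷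
    (1 , 2 , 3 , 5 , 10) ∷
    (1 , 2 , 4 , 4 , 6) ∷
    (1 , 2 , 4 , 9 , 11) ∷
    (1 , 2 , 6 , 7 , 13) ∷
    (1 , 2 , 8 , 11 , 12) ∷
    (1 , 2 , 10 , 10 , 12) ∷
    (1 , 3 , 3 , 4 , 6) ∷
    (1 , 3 , 3 , 9 , 11) ∷
    (1 , 3 , 4 , 4 , 10) ∷
    (1 , 3 , 4 , 5 , 5) ∷
    (1 , 3 , 4 , 5 , 8) ∷
    (1 , 3 , 4 , 7 , 7) ∷
    (1 , 3 , 6 , 6 , 7) ∷
    (1 , 3 , 7 , 8 , 16) ∷
    (1 , 3 , 9 , 14 , 15) ∷
    (1 , 4 , 5 , 8 , 9) ∷
    (1 , 4 , 7 , 7 , 9) ∷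
    (1 , 5 , 5 , 6 , 7) ∷
    (1 , 6 , 6 , 7 , 9) ∷
    (1 , 6 , 7 , 8 , 8) ∷
    (2 , 2 , 2 , 3 , 4) ∷
    (2 , 2 , 2 , 5 , 6) ∷
    (2 , 2 , 2 , 6 , 8) ∷
    (2 , 2 , 2 , 9 , 16) ∷
    (2 , 2 , 3 , 3 , 3) ∷
    (2 , 2 , 3 , 5 , 10) ∷
    (2 , 2 , 4 , 4 , 6) ∷
    (2 , 2 , 4 , 9 , 11) ∷
    (2 , 2 , 6 , 7 , 13) ∷
    (2 , 2 , 8 , 11 , 12) ∷
    (2 , 2 , 10 , 10 , 12) ∷
    (2 , 3 , 3 , 4 , 6) ∷
    (2 , 3 , 3 , 9 , 11) ∷
    (2 , 3 , 4 , 4 , 10) ∷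
    (2 , 3 , 4 , 5 , 5) ∷
    (2 , 3 , 4 , 5 , 8) ∷
    (2 , 3 , 4 , 7 , 7) ∷
    (2 , 3 , 6 , 6 , 7) ∷
    (2 , 3 , 7 , 8 , 16) ∷
    (2 , 3 , 9 , 14 , 15) ∷
    (2 , 4 , 5 , 8 , 9) ∷
    (2 , 4 , 7 , 7 , 9) ∷
    (2 , 5 , 5 , 6 , 7) ∷
    (2 , 6 , 6 , 7 , 9) ∷
    (2 , 6 , 7 , 8 , 8) ∷
    (3 , 3 , 3 , 3 , 6) ∷
    (3 , 3 , 3 , 4 , 10) ∷
    (3 , 3 , 3 , 5 , 5) ∷
    (3 , 3 , 3 , 5 , 8) ∷
    (3 , 3 , 3 , 7 , 7) ∷
    (3 , 3 , 5 , 8 , 9) ∷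
    (3 , 3 , 7 , 7 , 9) ∷
    (3 , 4 , 4 , 4 , 5) ∷
    (3 , 4 , 4 , 4 , 8) ∷
    (3 , 4 , 5 , 7 , 13) ∷
    (3 , 4 , 7 , 8 , 11) ∷
    (3 , 4 , 7 , 10 , 10) ∷
    (3 , 4 , 9 , 9 , 10) ∷
    (3 , 5 , 6 , 6 , 13) ∷
    (3 , 6 , 6 , 8 , 11) ∷
    (3 , 6 , 6 , 10 , 10) ∷
    (3 , 6 , 7 , 11 , 12) ∷
    (3 , 8 , 9 , 10 , 12) ∷
    (3 , 8 , 10 , 11 , 11) ∷
    (3 , 10 , 10 , 10 , 11) ∷
    (4 , 4 , 4 , 8 , 9) ∷
    (4 , 4 , 5 , 6 , 7) ∷
    (4 , 5 , 6 , 6 , 6) ∷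
    (4 , 5 , 6 , 8 , 16) ∷
    (4 , 6 , 7 , 7 , 16) ∷
    (4 , 7 , 8 , 14 , 15) ∷
    (4 , 9 , 12 , 13 , 15) ∷
    (4 , 9 , 13 , 14 , 14) ∷
    (4 , 11 , 11 , 13 , 15) ∷
    (5 , 5 , 5 , 6 , 13) ∷
    (5 , 5 , 6 , 8 , 11) ∷
    (5 , 5 , 6 , 10 , 10) ∷
    (5 , 5 , 7 , 11 , 12) ∷
    (5 , 6 , 7 , 7 , 11) ∷
    (5 , 7 , 8 , 9 , 10) ∷
    (5 , 8 , 9 , 9 , 9) ∷
    (6 , 6 , 6 , 7 , 16) ∷
    (6 , 6 , 8 , 14 , 15) ∷
    (6 , 10 , 14 , 16 , 20) ∷
    (7 , 7 , 7 , 9 , 10) ∷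
    (7 , 7 , 9 , 9 , 9) ∷
    []

{-# OPTIONS --safe #-}

-- Linear forms in logarithms are avoided: the powers 2 ^ a with a ≥ 24 are excluded by congruences alone.
-- Indices are considered modulo N and the exponent modulo A.  As N runs through 24, 120, 240, 480, …,
-- 120 * 2 ^ 20, the classes that survive at one level are lifted to the next one and tested modulo a power
-- of 2, where 2 ^ a vanishes, and modulo primes whose Fibonacci period divides N and whose residues contain
-- few powers of 2.  Congruences do not distinguish positive from negative indices, so they cannot exclude
-- families such as Fₙ + F₋ₙ + 3 + 34 + 987 = 2 ^ 10 (n even) or the solution
-- F₃₅ + F₋₃₀ + F₋₂₀ + F₋₁₀ + F₄ = 2 ^ 23; all of these disappear modulo 2 ^ 24.
-- The powers below 2 ^ 24 are treated by a search on the largest index.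
module Submission where

open import Defs
open import Data.Nat using (ℕ; zero; suc; pred; _+_; _*_; _∸_; _^_; _≤_; _<_; _≥_;
  _≡ᵇ_; _<ᵇ_; _≤ᵇ_; _≟_; _≤?_; _<?_; z≤n; s≤s; _/_; _%_)
open import Data.Nat.DivMod hiding (_mod_)
open import Data.Nat.Divisibility using (_∣_; divides; _∣0; m%n≡0⇒n∣m; 0∣⇒≡0)
open import Data.Nat.GeneralisedArithmetic using () renaming (iterate to iterated)
open import Data.Nat.ListAction using (sum; product)
open import Data.Nat.Properties
open import Data.Nat.Solver using (module +-*-Solver)
open import Data.Bool using (Bool; true; false; _∧_; T)
open import Data.Bool.Properties using (T-≡; ∧-conicalˡ; ∧-conicalʳ)
open import Data.Empty using (⊥; ⊥-elim)
open import Data.List.Base using (List; []; _∷_; map; foldr; iterate; cartesianProduct; upTo; length; _ʳ++_)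
open import Data.List.Membership.Propositional using (_∈_)
open import Data.List.Membership.Propositional.Properties using (∈-cartesianProduct⁺; ∈-upTo⁺)
import Data.List.Membership.DecPropositional as DecMembership
open import Data.List.Relation.Binary.Pointwise using (Pointwise; []; _∷_)
open import Data.List.Relation.Unary.All as All using (All; []; _∷_; all?)
open import Data.List.Relation.Unary.Any as Any using (Any; here; there; any?)
import Data.List.Relation.Unary.Any.Properties as Any
open import Data.Product using (_×_; _,_; ∃-syntax; proj₁; proj₂)
open import Data.Product.Properties using (≡-dec)
open import Data.Sum using (_⊎_; inj₁; inj₂; [_,_]′)
open import Function.Base using (_∘_)
open import Function.Bundles using (_⇔_; mk⇔; Equivalence)
open import Relation.Binary.Bundles using (Setoid)
import Relation.Binary.Reasoning.Setoid as SetoidReasoning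
open import Relation.Binary.PropositionalEquality using (_≡_; refl; sym; trans; cong; cong₂; subst; module ≡-Reasoning)
open import Relation.Nullary.Decidable using (Dec; yes; no; does; _×-dec_; _⊎-dec_)
open import Relation.Nullary.Negation using (contradiction)

open +-*-Solver using (solve; _:=_; _:+_; _:*_; con)

-- Congruences

infixl 7 _mod_
-- Total in the modulus, so that the moduli in a list of steps carry no proof of being nonzero;
-- congruence modulo 0 is equality.
_mod_ : ℕ → ℕ → ℕ
x mod zero  = x
x mod suc m = x % suc m

0-mod : ∀ m → 0 mod m ≡ 0
0-mod zero    = refl
0-mod (suc m) = refl

mod-mod : ∀ x m → (x mod m) mod m ≡ x mod m
mod-mod x zero    = refl
mod-mod x (suc m) = m%n%n≡m%n x (suc m)

mod-+ : ∀ x y m → (x + y) mod m ≡ (x mod m + y mod m) mod m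
mod-+ x y zero    = refl
mod-+ x y (suc m) = %-distribˡ-+ x y (suc m)

mod-* : ∀ x y m → (x * y) mod m ≡ ((x mod m) * (y mod m)) mod m
mod-* x y zero    = refl
mod-* x y (suc m) = %-distribˡ-* x y (suc m)

mod≡0⇒∣ : ∀ x m → x mod m ≡ 0 → m ∣ x
mod≡0⇒∣ x zero    refl = 0 ∣0
mod≡0⇒∣ x (suc m) eq   = m%n≡0⇒n∣m x (suc m) eq

infix 4 _≈_[mod_]
-- A record, so that `x`, `y` and `m` can be inferred from the type, which a bare equation between
-- residues does not allow.
record _≈_[mod_] (x y m : ℕ) : Set where
  constructor residues
  field equal : x mod m ≡ y mod m
open _≈_[mod_]

module _ {m : ℕ} where
  ≈-refl : ∀ {x} → x ≈ x [mod m ]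
  ≈-refl = residues refl

  ≈-reflexive : ∀ {x y} → x ≡ y → x ≈ y [mod m ]
  ≈-reflexive refl = ≈-refl

  ≈-sym : ∀ {x y} → x ≈ y [mod m ] → y ≈ x [mod m ]
  ≈-sym (residues p) = residues (sym p)

  ≈-trans : ∀ {x y z} → x ≈ y [mod m ] → y ≈ z [mod m ] → x ≈ z [mod m ]
  ≈-trans (residues p) (residues q) = residues (trans p q)

  +-cong-≈ : ∀ {x x′ y y′} → x ≈ x′ [mod m ] → y ≈ y′ [mod m ] → x + y ≈ x′ + y′ [mod m ]
  +-cong-≈ {x} {x′} {y} {y′} (residues p) (residues q) = residues
    (trans (mod-+ x y m) (trans (cong₂ (λ u v → (u + v) mod m) p q) (sym (mod-+ x′ y′ m))))

  *-cong-≈ : ∀ {x x′ y y′} → x ≈ x′ [mod m ] → y ≈ y′ [mod m ] → x * y ≈ x′ * y′ [mod m ]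
  *-cong-≈ {x} {x′} {y} {y′} (residues p) (residues q) = residues
    (trans (mod-* x y m) (trans (cong₂ (λ u v → (u * v) mod m) p q) (sym (mod-* x′ y′ m))))

  ^-cong-≈ : ∀ {x x′} → x ≈ x′ [mod m ] → ∀ e → x ^ e ≈ x′ ^ e [mod m ]
  ^-cong-≈ p zero    = ≈-refl
  ^-cong-≈ p (suc e) = *-cong-≈ p (^-cong-≈ p e)

  mod-≈ : ∀ {x} → x mod m ≈ x [mod m ]
  mod-≈ {x} = residues (mod-mod x m)

  multiple-≈0 : ∀ {x} → x ≈ 0 [mod m ] → ∀ y → x * y ≈ 0 [mod m ]
  multiple-≈0 p y = *-cong-≈ p (≈-refl {y})

≈-setoid : ℕ → Setoid _ _
≈-setoid m = record
  { Carrier = ℕ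
  ; _≈_ = λ x y → x ≈ y [mod m ]
  ; isEquivalence = record { refl = ≈-refl ; sym = ≈-sym ; trans = ≈-trans }
  }

module ≈-Reasoning (m : ℕ) = SetoidReasoning (≈-setoid m)

≈-∣ : ∀ {d m x y} → d ∣ m → x ≈ y [mod m ] → x ≈ y [mod d ]
≈-∣ {zero}  d∣m p with refl ← 0∣⇒≡0 d∣m = p
≈-∣ {suc d} {zero}  d∣m (residues refl) = ≈-refl
≈-∣ {suc d} {suc m} {x} {y} d∣m (residues p) = residues (begin
  x % suc d             ≡⟨ m∣n⇒o%n%m≡o%m (suc d) (suc m) x d∣m ⟨
  x % suc m % suc d     ≡⟨ cong (_% suc d) p ⟩
  y % suc m % suc d     ≡⟨ m∣n⇒o%n%m≡o%m (suc d) (suc m) y d∣m ⟩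
  y % suc d             ∎)
  where open ≡-Reasoning

squarings : ℕ → ℕ → ℕ → ℕ
squarings m zero    x = x
squarings m (suc k) x = squarings m k ((x * x) mod m)

-- The exponent is `e * 2 ^ k`; reduction after each of the `k` squarings keeps the numbers small.
power : (m e k x : ℕ) → ℕ
power m e k x = squarings m k (((x mod m) ^ e) mod m)

squarings-spec : ∀ m k x → squarings m k (x mod m) ≡ (x ^ (2 ^ k)) mod m
squarings-spec m zero    x = cong (_mod m) (sym (*-identityʳ x))
squarings-spec m (suc k) x = begin
  squarings m k ((x mod m * (x mod m)) mod m)  ≡⟨ cong (squarings m k) (mod-* x x m) ⟨
  squarings m k ((x * x) mod m)                ≡⟨ squarings-spec m k (x * x) ⟩
  ((x * x) ^ (2 ^ k)) mod m                    ≡⟨ cong (λ y → ((x * y) ^ (2 ^ k)) mod m) (*-identityʳ x) ⟨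
  ((x ^ 2) ^ (2 ^ k)) mod m                    ≡⟨ cong (_mod m) (^-*-assoc x 2 (2 ^ k)) ⟩
  (x ^ (2 ^ suc k)) mod m                      ∎
  where open ≡-Reasoning

power-spec : ∀ m e k x → power m e k x ≡ (x ^ (e * 2 ^ k)) mod m
power-spec m e k x = begin
  squarings m k (((x mod m) ^ e) mod m)  ≡⟨ cong (squarings m k) (equal (^-cong-≈ (mod-≈ {m} {x}) e)) ⟩
  squarings m k ((x ^ e) mod m)          ≡⟨ squarings-spec m k (x ^ e) ⟩
  ((x ^ e) ^ (2 ^ k)) mod m              ≡⟨ cong (_mod m) (^-*-assoc x e (2 ^ k)) ⟩
  (x ^ (e * 2 ^ k)) mod m                ∎
  where open ≡-Reasoning

-- Fibonacci identities

fib-+ : ∀ r n → fib (r + suc n) ≡ fib r * fib n + fib (suc r) * fib (suc n)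
fib-+ zero    n = sym (+-identityʳ (fib (suc n)))
fib-+ (suc r) n = begin
  fib (suc (r + suc n))
    ≡⟨ cong fib (+-suc r (suc n)) ⟨
  fib (r + suc (suc n))
    ≡⟨ fib-+ r (suc n) ⟩
  fib r * fib (suc n) + fib (suc r) * (fib (suc n) + fib n)
    ≡⟨ solve 4 (λ x y p q → x :* q :+ y :* (q :+ p) := y :* p :+ (y :+ x) :* q) refl
         (fib r) (fib (suc r)) (fib n) (fib (suc n)) ⟩
  fib (suc r) * fib n + fib (suc (suc r)) * fib (suc n) ∎
  where open ≡-Reasoning

-- At even positions the sign in Cassini's identity is fixed, so no subtraction occurs. The
-- induction step adds one quadratic form to both sides of the previous case.
cassini : ∀ h → fib (suc (h * 2)) * fib (suc (h * 2)) ≡ fib (h * 2) * fib (2 + h * 2) + 1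
cassini zero    = refl
cassini (suc h) = begin
  (y + x + y) * (y + x + y)
    ≡⟨ solve 2 (λ x y → (y :+ x :+ y) :* (y :+ x :+ y) :=
                        y :* y :+ (x :* x :+ con 3 :* y :* y :+ con 4 :* x :* y)) refl x y ⟩
  y * y + (x * x + 3 * y * y + 4 * x * y)
    ≡⟨ cong (_+ (x * x + 3 * y * y + 4 * x * y)) (cassini h) ⟩
  x * (y + x) + 1 + (x * x + 3 * y * y + 4 * x * y)
    ≡⟨ solve 2 (λ x y → x :* (y :+ x) :+ con 1 :+ (x :* x :+ con 3 :* y :* y :+ con 4 :* x :* y) :=
                        (y :+ x) :* (y :+ x :+ y :+ (y :+ x)) :+ con 1) refl x y ⟩
  (y + x) * (y + x + y + (y + x)) + 1 ∎
  where
  open ≡-Reasoning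
  x = fib (h * 2)
  y = fib (suc (h * 2))

fib-mono-suc : ∀ n → fib n ≤ fib (suc n)
fib-mono-suc zero    = z≤n
fib-mono-suc (suc n) = m≤m+n (fib (suc n)) (fib n)

fib-mono : ∀ {m n} → m ≤ n → fib m ≤ fib n
fib-mono {m} {zero} z≤n = ≤-refl
fib-mono {m} {suc n} m≤1+n with m≤n⇒m<n∨m≡n m≤1+n
... | inj₁ (s≤s m≤n) = ≤-trans (fib-mono m≤n) (fib-mono-suc n)
... | inj₂ refl      = ≤-refl

-- suc N is a period of the Fibonacci sequence modulo m.
record Period (m N : ℕ) : Set where
  field
    fib-N   : fib N ≈ 1 [mod m ]
    fib-1+N : fib (suc N) ≈ 0 [mod m ]

module _ {m N : ℕ} (period : Period m N) where
  open Period period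

  fib-periodic : ∀ r q → fib (r + q * suc N) ≈ fib r [mod m ]
  fib-periodic r zero    = ≈-reflexive (cong fib (+-identityʳ r))
  fib-periodic r (suc q) = begin
    fib (r + (suc N + q * suc N))
      ≡⟨ cong fib (solve 3 (λ r n x → r :+ (n :+ x) := (r :+ x) :+ n) refl r (suc N) (q * suc N)) ⟩
    fib (s + suc N)
      ≡⟨ fib-+ s N ⟩
    fib s * fib N + fib (suc s) * fib (suc N)
      ≈⟨ +-cong-≈ (*-cong-≈ (≈-refl {x = fib s}) fib-N) (*-cong-≈ (≈-refl {x = fib (suc s)}) fib-1+N) ⟩
    fib s * 1 + fib (suc s) * 0
      ≡⟨ solve 2 (λ x y → x :* con 1 :+ y :* con 0 := x) refl (fib s) (fib (suc s)) ⟩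
    fib s
      ≈⟨ fib-periodic r q ⟩
    fib r ∎
    where
    open ≈-Reasoning m
    s = r + q * suc N

  -- n * N is - n modulo the period, and F₋ₙ = Fₙ for odd n.
  fib-reflect : ∀ h → let n = suc (h * 2) in fib (n * N) ≈ fib n [mod m ]
  -- The addition formula at `- n + n` and `- n + n + 1` gives the linear equations `eq₀` and `eq₁`
  -- for `X` and `Y`. Their determinant `x * z - y * y` is -1 by `cassini`, and the chain solves
  -- them for `X`.
  fib-reflect h = ≈-sym (begin
    y
      ≡⟨ *-identityʳ y ⟨
    y * 1
      ≈⟨ *-cong-≈ (≈-refl {x = y}) eq₁ ⟨
    y * (X * y + Y * z)
      ≡⟨ solve 4 (λ X Y y z → y :* (X :* y :+ Y :* z) := X :* (y :* y) :+ Y :* y :* z) refl X Y y z ⟩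
    X * (y * y) + Y * y * z
      ≡⟨ cong (λ u → X * u + Y * y * z) (cassini h) ⟩
    X * (x * z + 1) + Y * y * z
      ≡⟨ solve 5 (λ X Y x y z → X :* (x :* z :+ con 1) :+ Y :* y :* z := (X :* x :+ Y :* y) :* z :+ X)
           refl X Y x y z ⟩
    (X * x + Y * y) * z + X
      ≈⟨ +-cong-≈ (multiple-≈0 eq₀ z) (≈-refl {x = X}) ⟩
    X ∎)
    where
    open ≈-Reasoning m
    n = suc (h * 2)
    X = fib (n * N)
    Y = fib (suc (n * N))
    x = fib (h * 2)
    y = fib n
    z = fib (suc n)
    n*N+n≡n*1+N : n * N + n ≡ n * suc N
    n*N+n≡n*1+N = trans (+-comm (n * N) n) (sym (*-suc n N))
    eq₀ : X * x + Y * y ≈ 0 [mod m ]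
    eq₀ = begin
      X * x + Y * y      ≡⟨ fib-+ (n * N) (h * 2) ⟨
      fib (n * N + n)    ≡⟨ cong fib n*N+n≡n*1+N ⟩
      fib (n * suc N)    ≈⟨ fib-periodic 0 n ⟩
      0                  ∎
    eq₁ : X * y + Y * z ≈ 1 [mod m ]
    eq₁ = begin
      X * y + Y * z            ≡⟨ fib-+ (n * N) n ⟨
      fib (n * N + suc n)      ≡⟨ cong fib (trans (+-suc (n * N) n) (cong suc n*N+n≡n*1+N)) ⟩
      fib (1 + n * suc N)      ≈⟨ fib-periodic 1 n ⟩
      1                        ∎

-- Boolean tests

infixr 3 _⇒_
_⇒_ : Bool → Bool → Bool
true  ⇒ b = b
false ⇒ b = true

⇒-elim : ∀ {a b} → a ≡ true → (a ⇒ b) ≡ true → b ≡ true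
⇒-elim refl p = p

∧-elimˡ : ∀ {a b} → a ∧ b ≡ true → a ≡ true
∧-elimˡ {a} {b} = ∧-conicalˡ a b

∧-elimʳ : ∀ {a b} → a ∧ b ≡ true → b ≡ true
∧-elimʳ {a} {b} = ∧-conicalʳ a b

from-T : ∀ {b} → T b → b ≡ true
from-T = Equivalence.to T-≡

to-T : ∀ {b} → b ≡ true → T b
to-T = Equivalence.from T-≡

≡ᵇ-complete : ∀ {m n} → m ≡ n → (m ≡ᵇ n) ≡ true
≡ᵇ-complete {m} {n} = from-T ∘ ≡⇒≡ᵇ m n

≡ᵇ-sound : ∀ {m n} → (m ≡ᵇ n) ≡ true → m ≡ n
≡ᵇ-sound {m} {n} = ≡ᵇ⇒≡ m n ∘ to-T

does-sound : ∀ {P : Set} (P? : Dec P) → does P? ≡ true → P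
does-sound (yes p) _ = p

allOf : {A : Set} → (A → Bool) → List A → Bool
allOf f []       = true
allOf f (x ∷ xs) = f x ∧ allOf f xs

allOf-∈ : ∀ {A : Set} {f : A → Bool} {x xs} → x ∈ xs → allOf f xs ≡ true → f x ≡ true
allOf-∈ (here refl) p = ∧-elimˡ p
allOf-∈ {f = f} {xs = y ∷ _} (there x∈) p = allOf-∈ x∈ (∧-elimʳ {f y} p)

iterated-∈ : ∀ {A : Set} (f : A → A) x {i k} → i < k → iterated f x i ∈ iterate f x k
iterated-∈ f x {zero}  {suc k} _         = here refl
iterated-∈ f x {suc i} {suc k} (s≤s i<k) = there (iterated-∈ f (f x) i<k)

-- Search trees with repeated keys

data Tree (A : Set) : Set where
  leaf : Tree A
  node : Tree A → ℕ → A → Tree A → Tree A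

module _ {A : Set} where
  insert : ℕ → A → Tree A → Tree A
  insert j x leaf = node leaf j x leaf
  insert j x (node l i y r) with j <ᵇ i
  ... | true  = node (insert j x l) i y r
  ... | false = node l i y (insert j x r)

  -- Equal keys are inserted to the right, so all entries with key `j` lie on a single path.
  allAt : (A → Bool) → ℕ → Tree A → Bool
  allAt f j leaf = true
  allAt f j (node l i y r) with j <ᵇ i
  ... | true  = allAt f j l
  ... | false = ((j ≡ᵇ i) ⇒ f y) ∧ allAt f j r

  allAt-inserted : ∀ f j x t → allAt f j (insert j x t) ≡ true → f x ≡ true
  allAt-inserted f j x leaf p with j <ᵇ j in eq
  ... | true  = contradiction (<ᵇ⇒< j j (to-T eq)) (n≮n j)
  ... | false = ⇒-elim (≡ᵇ-complete {j} refl) (∧-elimˡ p)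
  allAt-inserted f j x (node l i y r) p with j <ᵇ i in eq
  ... | true  rewrite eq = allAt-inserted f j x l p
  ... | false rewrite eq = allAt-inserted f j x r (∧-elimʳ {(j ≡ᵇ i) ⇒ f y} p)

  allAt-rest : ∀ f j k x t → allAt f j (insert k x t) ≡ true → allAt f j t ≡ true
  allAt-rest f j k x leaf p = refl
  allAt-rest f j k x (node l i y r) p with k <ᵇ i | j <ᵇ i in eq
  ... | true  | true  rewrite eq = allAt-rest f j k x l p
  ... | true  | false rewrite eq = p
  ... | false | true  rewrite eq = p
  ... | false | false rewrite eq = cong₂ _∧_ (∧-elimˡ p) (allAt-rest f j k x r (∧-elimʳ {(j ≡ᵇ i) ⇒ f y} p))

  index : (A → ℕ) → List A → Tree A
  index key = foldr (λ x → insert (key x) x) leaf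

  allAt-index : ∀ {f key j x xs} → x ∈ xs → j ≡ key x → allAt f j (index key xs) ≡ true → f x ≡ true
  allAt-index {f} {key} {xs = y ∷ ys} (here refl) refl p = allAt-inserted f (key y) y (index key ys) p
  allAt-index {f} {key} {j} {xs = y ∷ ys} (there x∈) eq p =
    allAt-index x∈ eq (allAt-rest f j (key y) y (index key ys) p)

-- The sieve

-- A residue class r of indices is held as (fib r , fib (1 + r)) modulo M, and the period N of a level
-- as the pair of the index N - 1; a residue class α of exponents is held as 2 ^ α modulo M.
Pair : Set
Pair = ℕ × ℕ

total : List Pair → ℕ
total vs = sum (map proj₁ vs)

fibSum : List ℕ → ℕ
fibSum ns = sum (map fib ns)

-- Each step keeps the candidates that satisfy a necessary condition:
--   vanishing m          m divides the sum;
--   matching m e k       the sum and 2 ^ a have the same power of exponent e * 2 ^ k modulo m, which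
--                        depends only on the class of a if 2 ^ (A * e * 2 ^ k) ≡ 1;
--   refineExponent k     replaces A by k * A;
--   refineIndices k m    replaces N by k * N and keeps the sums divisible by m;
--   meetInMiddle k l m   replaces N by k * N and A by l * A and keeps the sums congruent to 2 ^ a modulo m,
--                        looking up 2 ^ a minus the other terms among the sums of the first two.
data Step : Set where
  vanishing      : (m : ℕ) → Step
  matching       : (m e k : ℕ) → Step
  refineExponent : (k : ℕ) → Step
  refineIndices  : (k m : ℕ) → Step
  meetInMiddle   : (k l m : ℕ) → Step

branch : (List Pair → ℕ → Bool) → List Pair → ℕ → List (List Pair) → Bool
branch f vs s []             = f vs s
branch f vs s ([] ∷ os)      = true
branch f vs s ((v ∷ o) ∷ os) = branch f (v ∷ vs) (proj₁ v + s) os ∧ branch f vs s (o ∷ os)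

pairKey : ℕ → Pair × Pair → ℕ
pairKey m (u , v) = (proj₁ u + proj₁ v) mod m

meet : (List Pair → ℕ → Bool) → ℕ → Tree (Pair × Pair) → List ℕ → List Pair → ℕ → Bool
meet f m tree bs vs s =
  -- `m ∸ s mod m` is `- s` modulo `m`, so the key is the residue that the two missing terms must
  -- contribute.
  allOf (λ b → allAt (λ (x , y) → f (x ∷ y ∷ vs) b) ((b + (m ∸ s mod m)) mod m) tree) bs

-- A class stays available after it is chosen; the sum is symmetric, so one order of each selection
-- suffices.
multisets : (List Pair → Bool) → List Pair → ℕ → List Pair → Bool
multisets f cs       zero    vs = f vs
multisets f []       (suc k) vs = true
multisets f (c ∷ cs) (suc k) vs = multisets f (c ∷ cs) k (c ∷ vs) ∧ multisets f cs (suc k) vs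

classes : List ℕ → List Pair
classes = map (λ r → fib r , fib (suc r))

-- An odd index may be replaced by its negative.
Covering : List ℕ → Set
Covering rs = ∀ n → n % 24 ∈ rs ⊎ (n % 24 % 2 ≡ 1 × (n % 24 * 23) % 24 ∈ rs)

-- The sieve excludes the sums that are congruent to 2 ^ a modulo M for some a ≥ E.
module Sieve (M E : ℕ) where
  shift : Pair → Pair → Pair
  shift (p , q) (x , y) = (x * p + y * q) mod M , (x * q + y * (p + q)) mod M

  times : ℕ → ℕ → ℕ
  times t b = (b * t) mod M

  children : Pair → ℕ → Pair → List Pair
  children c k v = iterate (shift c) v k

  -- run c t π vs b computes to true only if no tuple of indices in the classes vs and no exponent in
  -- the class b survive the steps π; c and t describe the period of the indices and of the exponent.
  run : Pair → ℕ → List Step → List Pair → ℕ → Bool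
  run c t []                       vs b = false
  run c t (vanishing m ∷ π)        vs b = (total vs mod m ≡ᵇ 0) ⇒ run c t π vs b
  run c t (matching m e k ∷ π)     vs b = (power m e k (total vs) ≡ᵇ power m e k b) ⇒ run c t π vs b
  run c t (refineExponent k ∷ π)   vs b =
    allOf (run c (iterated (times t) t (pred k)) π vs) (iterate (times t) b k)
  run c t (refineIndices k m ∷ π)  vs b =
    branch (λ ws s → (s mod m ≡ᵇ 0) ⇒ run (iterated (shift c) c (pred k)) t π ws b)
      [] 0 (map (children c k) vs)
  run c t (meetInMiddle k l m ∷ π) (u ∷ v ∷ vs) b =
    branch (meet (run (iterated (shift c) c (pred k)) (iterated (times t) t (pred l)) π) m
                 (index (pairKey m) (cartesianProduct (children c k u) (children c k v)))
                 (iterate (times t) b l))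
      [] 0 (map (children c k) vs)
  run c t (meetInMiddle k l m ∷ π) _ b = false

  -- The last test makes `m` a divisor of `M`, so that the residues stored modulo `M` determine
  -- those modulo `m`.
  isPeriod : Pair → ℕ → Bool
  isPeriod (p , q) m = (p mod m ≡ᵇ 1 mod m) ∧ (q mod m ≡ᵇ 0 mod m) ∧ (M mod m ≡ᵇ 0)

  -- Independent of the classes `vs` and `b`, so these conditions are checked once and not in every
  -- branch of `run`.
  valid : Pair → ℕ → List Step → Bool
  valid c t []                                   = true
  valid c t (vanishing m ∷ π)                    = isPeriod c m ∧ (2 ^ E mod m ≡ᵇ 0 mod m) ∧ valid c t π
  valid c t (matching m e k ∷ π)                 = isPeriod c m ∧ (power m e k t ≡ᵇ 1 mod m) ∧ valid c t π
  valid c t (refineExponent zero ∷ π)            = false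
  valid c t (refineExponent (suc k) ∷ π)         = valid c (iterated (times t) t k) π
  valid c t (refineIndices zero m ∷ π)           = false
  valid c t (refineIndices (suc k) m ∷ π)        =
    let c′ = iterated (shift c) c k in
    isPeriod c′ m ∧ (2 ^ E mod m ≡ᵇ 0 mod m) ∧ valid c′ t π
  valid c t (meetInMiddle (suc k) (suc l) (suc m) ∷ π) =
    let c′ = iterated (shift c) c k ; t′ = iterated (times t) t l in
    isPeriod c′ (suc m) ∧ (t′ mod suc m ≡ᵇ 1 mod suc m) ∧ valid c′ t′ π
  valid c t (meetInMiddle _ _ _ ∷ π)             = false

  -- Soundness of the steps

  infix 4 _∼_ _∼2^_
  record _∼_ (v : Pair) (r : ℕ) : Set where
    constructor _,_
    field
      current : proj₁ v ≈ fib r [mod M ]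
      next    : proj₂ v ≈ fib (suc r) [mod M ]

  record _∼2^_ (b α : ℕ) : Set where
    constructor powers
    field congruent : b ≈ 2 ^ α [mod M ]

  shift-∼ : ∀ {c v n r} → c ∼ n → v ∼ r → shift c v ∼ r + suc n
  shift-∼ {p , q} {x , y} {n} {r} (p≈ , q≈) (x≈ , y≈) =
    (begin
      (x * p + y * q) mod M                      ≈⟨ mod-≈ ⟩
      x * p + y * q                              ≈⟨ +-cong-≈ (*-cong-≈ x≈ p≈) (*-cong-≈ y≈ q≈) ⟩
      fib r * fib n + fib (suc r) * fib (suc n)  ≡⟨ fib-+ r n ⟨
      fib (r + suc n)                            ∎) ,
    (begin
      (x * q + y * (p + q)) mod M
        ≈⟨ mod-≈ ⟩
      x * q + y * (p + q)
        ≈⟨ +-cong-≈ (*-cong-≈ x≈ q≈) (*-cong-≈ y≈ (+-cong-≈ p≈ q≈)) ⟩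
      fib r * fib (suc n) + fib (suc r) * (fib n + fib (suc n))
        ≡⟨ cong (λ z → fib r * fib (suc n) + fib (suc r) * z) (+-comm (fib n) (fib (suc n))) ⟩
      fib r * fib (suc n) + fib (suc r) * fib (suc (suc n))
        ≡⟨ fib-+ r (suc n) ⟨
      fib (r + suc (suc n))
        ≡⟨ cong fib (+-suc r (suc n)) ⟩
      fib (suc (r + suc n)) ∎)
    where open ≈-Reasoning M

  shifts-∼ : ∀ {c n} → c ∼ n → ∀ i {v r} → v ∼ r → iterated (shift c) v i ∼ r + i * suc n
  shifts-∼ c∼n zero    {v} {r} v∼r = subst (v ∼_) (sym (+-identityʳ r)) v∼r
  shifts-∼ {c} {n} c∼n (suc i) {v} {r} v∼r =
    subst (iterated (shift c) (shift c v) i ∼_) (+-assoc r (suc n) (i * suc n))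
      (shifts-∼ c∼n i (shift-∼ c∼n v∼r))

  times-∼ : ∀ {t A b α} → t ∼2^ A → b ∼2^ α → times t b ∼2^ α + A
  times-∼ {t} {A} {b} {α} (powers t≈) (powers b≈) = powers (begin
    (b * t) mod M  ≈⟨ mod-≈ ⟩
    b * t          ≈⟨ *-cong-≈ b≈ t≈ ⟩
    2 ^ α * 2 ^ A  ≡⟨ ^-distribˡ-+-* 2 α A ⟨
    2 ^ (α + A)    ∎)
    where open ≈-Reasoning M

  powers-∼ : ∀ {t A} → t ∼2^ A → ∀ i {b α} → b ∼2^ α → iterated (times t) b i ∼2^ α + i * A
  powers-∼ t∼A zero {b} {α} b∼α = subst (b ∼2^_) (sym (+-identityʳ α)) b∼α
  powers-∼ {t} {A} t∼A (suc i) {b} {α} b∼α =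
    subst (iterated (times t) (times t b) i ∼2^_) (+-assoc α A (i * A))
      (powers-∼ t∼A i (times-∼ t∼A b∼α))

  record Residue (N : ℕ) (v : Pair) (n : ℕ) : Set where
    constructor residue
    field
      remainder quotient : ℕ
      decomposition      : n ≡ remainder + quotient * suc N
      represented        : v ∼ remainder

  record Exponent (A b a : ℕ) : Set where
    constructor exponent
    field
      remainder quotient : ℕ
      decomposition      : a ≡ remainder + quotient * A
      represented        : b ∼2^ remainder

  -- Divides `q` by `suc k`: the remainder selects the child class, the quotient belongs to the
  -- refined level.
  split : ∀ r q N k → r + q * N ≡ r + (q % suc k) * N + q / suc k * (suc k * N)
  split r q N k = begin
    r + q * N
      ≡⟨ cong (λ u → r + u * N) (m≡m%n+[m/n]*n q (suc k)) ⟩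
    r + (q % suc k + q / suc k * suc k) * N
      ≡⟨ solve 5 (λ r i j k n → r :+ (i :+ j :* k) :* n := r :+ i :* n :+ j :* (k :* n)) refl
           r (q % suc k) (q / suc k) (suc k) N ⟩
    r + (q % suc k) * N + q / suc k * (suc k * N) ∎
    where open ≡-Reasoning

  -- The new period `suc (N + k * suc N)` is `suc k * suc N` by definition.
  refine-residue : ∀ {N c v n} → c ∼ N → ∀ k → Residue N v n →
                   ∃[ w ] (w ∈ children c (suc k) v × Residue (N + k * suc N) w n)
  refine-residue {N} {c} {v} c∼N k (residue r q refl v∼r) =
    iterated (shift c) v i , iterated-∈ (shift c) v (m%n<n q (suc k)) ,
    residue (r + i * suc N) (q / suc k) (split r q (suc N) k) (shifts-∼ c∼N i v∼r)
    where i = q % suc k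

  refine-exponent : ∀ {A t b a} → t ∼2^ A → ∀ k → Exponent A b a →
                    ∃[ b′ ] (b′ ∈ iterate (times t) b (suc k) × Exponent (A + k * A) b′ a)
  refine-exponent {A} {t} {b} t∼A k (exponent α q refl b∼α) =
    iterated (times t) b i , iterated-∈ (times t) b (m%n<n q (suc k)) ,
    exponent (α + i * A) (q / suc k) (split α q A k) (powers-∼ t∼A i b∼α)
    where i = q % suc k

  branch-sound : ∀ {N f os ns vs ms} →
    Pointwise (λ o n → ∃[ w ] (w ∈ o × Residue N w n)) os ns → Pointwise (Residue N) vs ms →
    branch f vs (total vs) os ≡ true →
    ∃[ ws ] ∃[ ks ] (Pointwise (Residue N) ws ks × fibSum ks ≡ fibSum ns + fibSum ms × f ws (total ws) ≡ true)
  branch-sound [] vs~ms p = _ , _ , vs~ms , refl , p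
  branch-sound {ns = n ∷ ns} {ms = ms} ((w , here refl , w~n) ∷ os~ns) vs~ms p
    with ws , ks , ws~ks , eq , p′ ← branch-sound os~ns (w~n ∷ vs~ms) (∧-elimˡ p) =
    ws , ks , ws~ks ,
    trans eq (solve 3 (λ x y z → x :+ (y :+ z) := (y :+ x) :+ z) refl (fibSum ns) (fib n) (fibSum ms)) , p′
  branch-sound {N} {f} {os = (v ∷ o) ∷ os} {vs = vs} ((w , there w∈ , w~n) ∷ os~ns) vs~ms p =
    branch-sound {os = o ∷ os} ((w , w∈ , w~n) ∷ os~ns) vs~ms
      (∧-elimʳ {branch f (v ∷ vs) (proj₁ v + total vs) os} p)

  refine-residues : ∀ {N c vs ns} → c ∼ N → ∀ k → Pointwise (Residue N) vs ns →
    Pointwise (λ o n → ∃[ w ] (w ∈ o × Residue (N + k * suc N) w n)) (map (children c (suc k)) vs) ns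
  refine-residues c∼N k []           = []
  refine-residues c∼N k (v~n ∷ vs~ns) = refine-residue c∼N k v~n ∷ refine-residues c∼N k vs~ns

  isPeriod-∣ : ∀ c m → isPeriod c m ≡ true → m ∣ M
  isPeriod-∣ (p , q) m ok = mod≡0⇒∣ M m
    (≡ᵇ-sound (∧-elimʳ {q mod m ≡ᵇ 0 mod m} (∧-elimʳ {p mod m ≡ᵇ 1 mod m} ok)))

  isPeriod-sound : ∀ m {c N} → c ∼ N → isPeriod c m ≡ true → Period m N
  isPeriod-sound m {p , q} (p≈ , q≈) ok = record
    { fib-N   = ≈-trans (≈-sym (≈-∣ m∣M p≈)) (residues (≡ᵇ-sound (∧-elimˡ ok)))
    ; fib-1+N = ≈-trans (≈-sym (≈-∣ m∣M q≈))
                  (residues (≡ᵇ-sound (∧-elimˡ (∧-elimʳ {p mod m ≡ᵇ 1 mod m} ok))))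
    }
    where m∣M = isPeriod-∣ (p , q) m ok

  total-≈ : ∀ {m N vs ns} → m ∣ M → Period m N → Pointwise (Residue N) vs ns → total vs ≈ fibSum ns [mod m ]
  total-≈ m∣M period [] = ≈-refl
  total-≈ m∣M period (residue r q refl (x≈ , _) ∷ vs~ns) =
    +-cong-≈ (≈-trans (≈-∣ m∣M x≈) (≈-sym (fib-periodic period r q))) (total-≈ m∣M period vs~ns)

  -- The surplus factor `2 ^ (j * A)` becomes a power of `t ^ d` and disappears, even if 2 has an
  -- order modulo `m` that does not divide `A`.
  exponent-≈ : ∀ {m t A b a} d → m ∣ M → t ∼2^ A → t ^ d ≈ 1 [mod m ] → Exponent A b a →
               (2 ^ a) ^ d ≈ b ^ d [mod m ]
  exponent-≈ {m} {t} {A} {b} d m∣M (powers t≈) t^d≈1 (exponent α j refl (powers b≈)) = begin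
    (2 ^ (α + j * A)) ^ d
      ≡⟨ ^-*-assoc 2 (α + j * A) d ⟩
    2 ^ ((α + j * A) * d)
      ≡⟨ cong (2 ^_) (solve 4 (λ α j A d → (α :+ j :* A) :* d := α :* d :+ A :* d :* j) refl α j A d) ⟩
    2 ^ (α * d + A * d * j)
      ≡⟨ ^-distribˡ-+-* 2 (α * d) (A * d * j) ⟩
    2 ^ (α * d) * 2 ^ (A * d * j)
      ≡⟨ cong₂ _*_ (^-*-assoc 2 α d)
           (trans (cong (_^ j) (^-*-assoc 2 A d)) (^-*-assoc 2 (A * d) j)) ⟨
    (2 ^ α) ^ d * ((2 ^ A) ^ d) ^ j
      ≈⟨ *-cong-≈ (^-cong-≈ (≈-∣ m∣M b≈) d) (^-cong-≈ (^-cong-≈ (≈-∣ m∣M t≈) d) j) ⟨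
    b ^ d * (t ^ d) ^ j
      ≈⟨ *-cong-≈ (≈-refl {x = b ^ d}) (^-cong-≈ t^d≈1 j) ⟩
    b ^ d * 1 ^ j
      ≡⟨ trans (cong (b ^ d *_) (^-zeroˡ j)) (*-identityʳ (b ^ d)) ⟩
    b ^ d ∎
    where open ≈-Reasoning m

  module _ {a : ℕ} (large : E ≤ a) where
    vanishing-sound : ∀ m {x} → (2 ^ E mod m ≡ᵇ 0 mod m) ≡ true → x ≈ 2 ^ a [mod m ] →
                      (x mod m ≡ᵇ 0) ≡ true
    vanishing-sound m {x} ok x≈ = ≡ᵇ-complete (trans (equal (begin
      x                    ≈⟨ x≈ ⟩
      2 ^ a                ≡⟨ cong (2 ^_) (m+[n∸m]≡n large) ⟨
      2 ^ (E + (a ∸ E))    ≡⟨ ^-distribˡ-+-* 2 E (a ∸ E) ⟩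
      2 ^ E * 2 ^ (a ∸ E)  ≈⟨ multiple-≈0 (residues (≡ᵇ-sound ok)) (2 ^ (a ∸ E)) ⟩
      0                    ∎)) (0-mod m))
      where open ≈-Reasoning m

    matching-sound : ∀ {m e k t A b x} → m ∣ M → t ∼2^ A → (power m e k t ≡ᵇ 1 mod m) ≡ true →
      Exponent A b a → x ≈ 2 ^ a [mod m ] → (power m e k x ≡ᵇ power m e k b) ≡ true
    matching-sound {m} {e} {k} {t} {A} {b} {x} m∣M t∼A ok b~a x≈ = ≡ᵇ-complete (begin
      power m e k x            ≡⟨ power-spec m e k x ⟩
      (x ^ (e * 2 ^ k)) mod m  ≡⟨ equal (≈-trans (^-cong-≈ x≈ (e * 2 ^ k))
                                           (exponent-≈ (e * 2 ^ k) m∣M t∼A t^d≈1 b~a)) ⟩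
      (b ^ (e * 2 ^ k)) mod m  ≡⟨ power-spec m e k b ⟨
      power m e k b            ∎)
      where
      open ≡-Reasoning
      t^d≈1 : t ^ (e * 2 ^ k) ≈ 1 [mod m ]
      t^d≈1 = residues (trans (sym (power-spec m e k t)) (≡ᵇ-sound ok))

    meet-sound : ∀ {f m x y xs ys b bs ws} → x ∈ xs → y ∈ ys → b ∈ bs →
      total (x ∷ y ∷ ws) ≈ b [mod suc m ] →
      meet f (suc m) (index (pairKey (suc m)) (cartesianProduct xs ys)) bs ws (total ws) ≡ true →
      f (x ∷ y ∷ ws) b ≡ true
    meet-sound {f} {m} {x} {y} {b = b} {ws = ws} x∈ y∈ b∈ eq p =
      allAt-index (∈-cartesianProduct⁺ x∈ y∈) (equal key≈) (allOf-∈ b∈ p)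
      where
      open ≈-Reasoning (suc m)
      s = total ws
      s′ = s % suc m
      z = proj₁ x + proj₁ y
      key≈ : b + (suc m ∸ s′) ≈ z [mod suc m ]
      key≈ = begin
        b + (suc m ∸ s′)                    ≈⟨ +-cong-≈ eq (≈-refl {x = suc m ∸ s′}) ⟨
        proj₁ x + (proj₁ y + s) + (suc m ∸ s′)
          ≡⟨ cong (_+ (suc m ∸ s′)) (+-assoc (proj₁ x) (proj₁ y) s) ⟨
        z + s + (suc m ∸ s′)
          ≈⟨ +-cong-≈ (+-cong-≈ (≈-refl {x = z}) (mod-≈ {suc m} {s})) (≈-refl {x = suc m ∸ s′}) ⟨
        z + s′ + (suc m ∸ s′)               ≡⟨ +-assoc z s′ (suc m ∸ s′) ⟩
        z + (s′ + (suc m ∸ s′))             ≡⟨ cong (z +_) (m+[n∸m]≡n (<⇒≤ (m%n<n s (suc m)))) ⟩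
        z + suc m                           ≈⟨ +-cong-≈ (≈-refl {x = z}) (residues (n%n≡0 (suc m))) ⟩
        z + 0                               ≡⟨ +-identityʳ z ⟩
        z                                   ∎

    -- Induction on the steps: the classes of an actual solution pass every test, so `run` would
    -- follow them to the empty list and return `false`.
    run-sound : ∀ π {N A c t vs b ns} → c ∼ N → t ∼2^ A → valid c t π ≡ true →
      Pointwise (Residue N) vs ns → Exponent A b a → fibSum ns ≈ 2 ^ a [mod M ] →
      run c t π vs b ≡ true → ⊥
    run-sound (vanishing m ∷ π) {c = c} c∼N t∼A ok vs~ns b~a sum≈ p =
      run-sound π c∼N t∼A (∧-elimʳ {2 ^ E mod m ≡ᵇ 0 mod m} (∧-elimʳ {isPeriod c m} ok)) vs~ns b~a sum≈
        (⇒-elim (vanishing-sound m (∧-elimˡ (∧-elimʳ {isPeriod c m} ok))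
          (≈-trans (total-≈ m∣M (isPeriod-sound m c∼N (∧-elimˡ ok)) vs~ns) (≈-∣ m∣M sum≈))) p)
      where m∣M = isPeriod-∣ c m (∧-elimˡ ok)
    run-sound (matching m e k ∷ π) {c = c} {t} c∼N t∼A ok vs~ns b~a sum≈ p =
      run-sound π c∼N t∼A (∧-elimʳ {power m e k t ≡ᵇ 1 mod m} (∧-elimʳ {isPeriod c m} ok)) vs~ns b~a sum≈
        (⇒-elim (matching-sound {m} {e} {k} m∣M t∼A (∧-elimˡ (∧-elimʳ {isPeriod c m} ok)) b~a
          (≈-trans (total-≈ m∣M (isPeriod-sound m c∼N (∧-elimˡ ok)) vs~ns) (≈-∣ m∣M sum≈))) p)
      where m∣M = isPeriod-∣ c m (∧-elimˡ ok)
    run-sound (refineExponent (suc k) ∷ π) c∼N t∼A ok vs~ns b~a sum≈ p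
      with b′ , b′∈ , b′~a ← refine-exponent t∼A k b~a =
      run-sound π c∼N (powers-∼ t∼A k t∼A) ok vs~ns b′~a sum≈ (allOf-∈ b′∈ p)
    run-sound (refineIndices (suc k) m ∷ π) {c = c} c∼N t∼A ok vs~ns b~a sum≈ p
      with ws , ks , ws~ks , eq , p′ ← branch-sound (refine-residues c∼N k vs~ns) [] p =
      run-sound π c′∼ t∼A (∧-elimʳ {2 ^ E mod m ≡ᵇ 0 mod m} (∧-elimʳ {isPeriod c′ m} ok)) ws~ks b~a sum≈′
        (⇒-elim (vanishing-sound m (∧-elimˡ (∧-elimʳ {isPeriod c′ m} ok))
          (≈-trans (total-≈ m∣M (isPeriod-sound m c′∼ (∧-elimˡ ok)) ws~ks) (≈-∣ m∣M sum≈′))) p′)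
      where
      c′ = iterated (shift c) c k
      c′∼ = shifts-∼ c∼N k c∼N
      m∣M = isPeriod-∣ c′ m (∧-elimˡ ok)
      sum≈′ = ≈-trans (≈-reflexive (trans eq (+-identityʳ _))) sum≈
    run-sound (meetInMiddle (suc k) (suc l) (suc m) ∷ π) {c = c} {t = t} {vs = u ∷ v ∷ vs} {ns = n₁ ∷ n₂ ∷ ns}
        c∼N t∼A ok (u~ ∷ v~ ∷ vs~ns) b~a sum≈ p
      with x , x∈ , x~ ← refine-residue c∼N k u~
         | y , y∈ , y~ ← refine-residue c∼N k v~
         | b′ , b′∈ , b′~a ← refine-exponent t∼A l b~a
         | ws , ks , ws~ks , eq , p′ ← branch-sound (refine-residues c∼N k vs~ns) [] p =
      run-sound π c′∼ (powers-∼ t∼A l t∼A)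
        (∧-elimʳ {t′ mod suc m ≡ᵇ 1 mod suc m} (∧-elimʳ {isPeriod c′ (suc m)} ok))
        (x~ ∷ y~ ∷ ws~ks) b′~a sum≈′
        (meet-sound {run c′ t′ π} x∈ y∈ b′∈
          (≈-trans (total-≈ m∣M (isPeriod-sound (suc m) c′∼ (∧-elimˡ ok)) (x~ ∷ y~ ∷ ws~ks))
            (≈-trans (≈-∣ m∣M sum≈′) 2^a≈b′)) p′)
      where
      c′ = iterated (shift c) c k
      c′∼ = shifts-∼ c∼N k c∼N
      t′ = iterated (times t) t l
      m∣M = isPeriod-∣ c′ (suc m) (∧-elimˡ ok)
      t′≈1 : t′ ^ 1 ≈ 1 [mod suc m ]
      t′≈1 = ≈-trans (≈-reflexive (*-identityʳ t′))
        (residues (≡ᵇ-sound (∧-elimˡ (∧-elimʳ {isPeriod c′ (suc m)} ok))))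
      2^a≈b′ : 2 ^ a ≈ b′ [mod suc m ]
      2^a≈b′ = ≈-trans (≈-reflexive (sym (*-identityʳ (2 ^ a))))
        (≈-trans (exponent-≈ 1 m∣M (powers-∼ t∼A l t∼A) t′≈1 b′~a) (≈-reflexive (*-identityʳ b′)))
      sum≈′ = ≈-trans (≈-reflexive (cong (λ z → fib n₁ + (fib n₂ + z)) (trans eq (+-identityʳ _)))) sum≈

  -- Reduction of arbitrary indices to the listed classes

  extract : ∀ {P : Pair → ℕ → Set} {c cs ns} → All (λ n → Any (λ v → P v n) (c ∷ cs)) ns →
    All (λ n → Any (λ v → P v n) cs) ns ⊎
    (∃[ n ] ∃[ ks ] (P c n × All (λ n → Any (λ v → P v n) (c ∷ cs)) ks ×
      length ns ≡ suc (length ks) × fibSum ns ≡ fib n + fibSum ks))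
  extract [] = inj₁ []
  extract (here p ∷ ps) = inj₂ (_ , _ , p , ps , refl , refl)
  extract {ns = m ∷ ns} (there p ∷ ps) with extract ps
  ... | inj₁ qs = inj₁ (p ∷ qs)
  ... | inj₂ (n , ks , q , qs , len , eq) = inj₂ (n , m ∷ ks , q , there p ∷ qs , cong suc len ,
    trans (cong (fib m +_) eq)
      (solve 3 (λ x y z → x :+ (y :+ z) := y :+ (x :+ z)) refl (fib m) (fib n) (fibSum ks)))

  -- `extract` selects the recursive call: either every index lies in a class of `cs`, or one in
  -- class `c` is moved to the front, which preserves the sum.
  multisets-sound : ∀ cs k {N f vs ns ms} →
    All (λ n → Any (λ v → Residue N v n) cs) ns → length ns ≡ k → Pointwise (Residue N) vs ms →
    multisets f cs k vs ≡ true →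
    ∃[ ws ] ∃[ ks ] (Pointwise (Residue N) ws ks × fibSum ks ≡ fibSum ns + fibSum ms × f ws ≡ true)
  multisets-sound cs       zero    {ns = []} [] refl vs~ms p = _ , _ , vs~ms , refl , p
  multisets-sound []       (suc k) (() ∷ _)
  multisets-sound (c ∷ cs) (suc k) {f = f} {vs = vs} {ns} {ms} ps len vs~ms p = [
    (λ qs → multisets-sound cs (suc k) qs len vs~ms (∧-elimʳ {multisets f (c ∷ cs) k (c ∷ vs)} p)) ,
    (λ (n , ks , c~n , qs , len′ , eq) →
      let ws , js , ws~js , eq′ , p′ = multisets-sound (c ∷ cs) k qs (suc-injective (trans (sym len′) len))
                                         (c~n ∷ vs~ms) (∧-elimˡ p) in
      ws , js , ws~js ,
      trans eq′ (trans (solve 3 (λ x y z → x :+ (y :+ z) := (y :+ x) :+ z) refl (fibSum ks) (fib n) (fibSum ms))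
                       (cong (_+ fibSum ms) (sym eq))) ,
      p′) ]′ (extract ps)

  module _ {rs : List ℕ} where
    class-of : ∀ n → n % 24 ∈ rs → Any (λ v → Residue 23 v n) (classes rs)
    class-of n n∈ = Any.map⁺ (Any.map
      (λ {r} eq → residue r (n / 24) (trans (m≡m%n+[m/n]*n n 24) (cong (_+ n / 24 * 24) eq)) (≈-refl , ≈-refl)) n∈)

    -- The exchanged index `n * N` is `- n` modulo the full period `suc N`, so it is valid modulo
    -- all of `M`; as `N` is 23 modulo 24, its class is that of `n * 23`.
    representative : ∀ {N} → Covering rs → Period M N → N % 24 ≡ 23 →
      ∀ n → ∃[ k ] (fib k ≈ fib n [mod M ] × Any (λ v → Residue 23 v k) (classes rs))
    representative {N} covering period N≡23 n with covering n
    ... | inj₁ n∈         = n , ≈-refl , class-of n n∈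
    ... | inj₂ (odd , n∈) =
      n * N ,
      subst (λ k → fib (k * N) ≈ fib k [mod M ]) (sym n≡) (fib-reflect period (n / 2)) ,
      class-of (n * N) (subst (_∈ rs)
        (sym (trans (%-distribˡ-* n N 24) (cong (λ x → (n % 24 * x) % 24) N≡23))) n∈)
      where
      n≡ : n ≡ suc (n / 2 * 2)
      n≡ = trans (m≡m%n+[m/n]*n n 2)
             (cong (_+ n / 2 * 2) (trans (sym (m∣n⇒o%n%m≡o%m 2 24 n (divides 12 refl))) odd))

    representative-list : ∀ {N} → Covering rs → Period M N → N % 24 ≡ 23 →
      ∀ ns → ∃[ ks ] (length ks ≡ length ns × fibSum ks ≈ fibSum ns [mod M ] ×
                      All (λ k → Any (λ v → Residue 23 v k) (classes rs)) ks)
    representative-list covering period N≡23 []       = [] , refl , ≈-refl , []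
    representative-list covering period N≡23 (n ∷ ns)
      with k , k≈ , k∈ ← representative covering period N≡23 n
         | ks , len , ks≈ , ks∈ ← representative-list covering period N≡23 ns =
      k ∷ ks , cong suc len , +-cong-≈ k≈ ks≈ , k∈ ∷ ks∈

  sieve-sound : ∀ π k {rs c t N} → Covering rs → c ∼ 23 → t ∼2^ 1 → valid c t π ≡ true →
    Period M N → N % 24 ≡ 23 →
    multisets (λ vs → run c t π vs 1) (classes rs) k [] ≡ true →
    ∀ {a} → E ≤ a → ∀ ns → length ns ≡ k → fibSum ns ≡ 2 ^ a → ⊥
  sieve-sound π k {rs} covering c∼23 t∼1 ok period N≡23 p {a} large ns len sum≡
    with ks , len′ , ks≈ , ks∈ ← representative-list covering period N≡23 ns
    with ws , js , ws~js , eq , p′ ← multisets-sound (classes rs) k ks∈ (trans len′ len) [] p =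
    -- With `A = 1` every exponent lies in the class of 0, represented by `2 ^ 0 = 1`.
    run-sound large π c∼23 t∼1 ok ws~js (exponent 0 a (sym (*-identityʳ a)) (powers ≈-refl))
      (≈-trans (≈-reflexive (trans eq (+-identityʳ _))) (≈-trans ks≈ (≈-reflexive sum≡))) p′

-- Large powers of two

-- A common multiple of the moduli below; their Fibonacci periods divide 120 * 2 ^ 20.
modulus : ℕ
modulus = 2 ^ 24 * product
  (5 ∷ 9 ∷ 11 ∷ 31 ∷ 41 ∷ 61 ∷ 2521 ∷ 7 ∷ 47 ∷ 127 ∷ 241 ∷ 641 ∷ 769 ∷ 1601 ∷
   3167 ∷ 4481 ∷ 7681 ∷ 12289 ∷ 61441 ∷ 163841 ∷ 1597441 ∷ 1689601 ∷ 3604481 ∷ 12042241 ∷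
   26214401 ∷ 76677121 ∷ 377487361 ∷ 1572864001 ∷ 2154823681 ∷ 266883563521 ∷ [])

-- The Fibonacci period modulo `2 ^ k` is `3 * 2 ^ (k - 1)`, so each doubling of `N` admits one more
-- factor 2. Exponents are taken modulo 6, 30, 60 and 120 in turn. The composite moduli are
-- `341 = 11 * 31`, `2501 = 41 * 61` and `12505 = 5 * 2501`.
plan : List Step
plan =
  vanishing 16 ∷ refineExponent 6 ∷ matching 9 1 0 ∷
  meetInMiddle 5 5 341 ∷ matching 2501 1 1 ∷ refineExponent 2 ∷ matching 12505 1 0 ∷ matching 2521 21 0 ∷
  refineIndices 2 32 ∷ matching 7 1 0 ∷ matching 241 1 1 ∷
  refineIndices 2 64 ∷ matching 1601 5 2 ∷ matching 47 23 0 ∷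
  refineIndices 2 128 ∷ matching 769 1 5 ∷ matching 3167 1583 0 ∷
  refineIndices 2 256 ∷ matching 641 1 4 ∷ matching 4481 7 2 ∷
  refineIndices 2 512 ∷ matching 127 7 0 ∷ refineExponent 2 ∷ matching 641 1 3 ∷
  refineIndices 2 1024 ∷ matching 7681 1 5 ∷
  refineIndices 2 2048 ∷ matching 1689601 5 6 ∷
  refineIndices 2 4096 ∷ matching 12289 1 8 ∷
  refineIndices 2 8192 ∷ matching 61441 1 7 ∷
  refineIndices 2 16384 ∷ matching 1597441 13 8 ∷
  refineIndices 2 32768 ∷ matching 12042241 49 8 ∷
  refineIndices 2 65536 ∷ matching 163841 1 11 ∷
  refineIndices 2 131072 ∷ matching 3604481 11 12 ∷
  refineIndices 2 262144 ∷ matching 76677121 39 12 ∷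
  refineIndices 2 524288 ∷
  refineIndices 2 1048576 ∷ matching 26214401 5 14 ∷
  refineIndices 2 2097152 ∷ matching 2154823681 137 16 ∷
  refineIndices 2 4194304 ∷ matching 1572864001 25 17 ∷
  refineIndices 2 8388608 ∷ matching 377487361 1 17 ∷
  refineIndices 2 16777216 ∷ matching 266883563521 2121 19 ∷ []

open Sieve modulus 24

-- The odd classes above 12 are left out as negatives of those below.
representatives : List ℕ
representatives = 0 ∷ 1 ∷ 2 ∷ 3 ∷ 4 ∷ 5 ∷ 6 ∷ 7 ∷ 8 ∷ 9 ∷ 10 ∷ 11 ∷ 12 ∷ 14 ∷ 16 ∷ 18 ∷ 20 ∷ 22 ∷ []

open DecMembership _≟_ using () renaming (_∈?_ to _∈ℕ?_)

covering : Covering representatives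
covering n = All.lookup
  (does-sound (all? (λ r → (r ∈ℕ? representatives) ⊎-dec ((r % 2 ≟ 1) ×-dec ((r * 23) % 24 ∈ℕ? representatives)))
                    (upTo 24)) refl)
  (∈-upTo⁺ (m%n<n n 24))

-- The Fibonacci numbers at 23 and 24, for the initial period 24.
c₀ : Pair
c₀ = 28657 , 46368

c₀∼23 : c₀ ∼ 23
c₀∼23 = residues refl , residues refl

double : Pair → Pair
double c = shift c c

doubles-∼ : ∀ i {c n} → c ∼ n → iterated double c i ∼ iterated (λ n → n + suc n) n i
doubles-∼ zero    c∼n = c∼n
doubles-∼ (suc i) c∼n = doubles-∼ i (shift-∼ c∼n c∼n)

abstract
  period : ∃[ N ] (Period modulus N × N % 24 ≡ 23)
  -- Four shifts multiply the period 24 by 5, and 20 doublings lead to `120 * 2 ^ 20`, which is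
  -- `suc N`.
  period = _ , isPeriod-sound modulus (doubles-∼ 20 (shifts-∼ c₀∼23 4 c₀∼23)) refl , ≡ᵇ-sound refl

-- Qualified names keep these types syntactically equal to the premises of sieve-sound, so that they are
-- not compared by running the sieve again.
plan-valid : Sieve.valid modulus 24 c₀ 2 plan ≡ true
plan-valid = refl

sieve-empty : multisets (λ vs → Sieve.run modulus 24 c₀ 2 plan vs 1) (classes representatives) 5 [] ≡ true
sieve-empty = refl

no-large-power : ∀ {a} → 24 ≤ a → ∀ ns → length ns ≡ 5 → fibSum ns ≡ 2 ^ a → ⊥
no-large-power = Sieve.sieve-sound modulus 24 plan 5 {representatives} {c₀} {2} {proj₁ period}
  covering c₀∼23 (powers ≈-refl) plan-valid (proj₁ (proj₂ period)) (proj₂ (proj₂ period)) sieve-empty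

-- Small powers of two

-- A separate function, since a let-bound pattern would evaluate the pair once for each projection.
fibStep : Pair → Pair
fibStep (x , y) = y , y + x

fibPair : ℕ → Pair
fibPair zero    = 0 , 1
fibPair (suc n) = fibStep (fibPair n)

fibPair≡ : ∀ n → fibPair n ≡ (fib n , fib (suc n))
fibPair≡ zero    = refl
fibPair≡ (suc n) rewrite fibPair≡ n = refl

-- Unlike fib, this is computed in linear time.
fastFib : ℕ → ℕ
fastFib n = proj₁ (fibPair n)

fastFib≡fib : ∀ n → fastFib n ≡ fib n
fastFib≡fib n = cong proj₁ (fibPair≡ n)

_≟₅_ : (s t : Tuple5) → Dec (s ≡ t)
_≟₅_ = ≡-dec _≟_ (≡-dec _≟_ (≡-dec _≟_ (≡-dec _≟_ _≟_)))

open DecMembership _≟₅_ using () renaming (_∈?_ to _∈₅?_)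

isSolution : List ℕ → Bool
isSolution (n₅ ∷ n₄ ∷ n₃ ∷ n₂ ∷ n₁ ∷ []) = does ((n₅ , n₄ , n₃ , n₂ , n₁) ∈₅? solutions)
isSolution _                             = false

-- The largest of k + 1 indices at most n that contribute a sum s is n itself or at most n - 1, and there is
-- none if s exceeds (k + 1) * fib n.
search : List ℕ → ℕ → ℕ → ℕ → Bool
search ms zero    s n       = (s ≡ᵇ 0) ⇒ isSolution ms
search ms (suc k) s zero    = true
search ms (suc k) s (suc n) = (s ≤ᵇ suc k * fastFib (suc n)) ⇒
  (((fastFib (suc n) ≤ᵇ s) ⇒ search (suc n ∷ ms) k (s ∸ fastFib (suc n)) (suc n)) ∧ search ms (suc k) s n)

data Descending : ℕ → List ℕ → Set where
  []    : ∀ {n} → Descending n []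
  chain : ∀ {n m ns} → 1 ≤ m → m ≤ n → Descending m ns → Descending n (m ∷ ns)

fibSum-bound : ∀ {n ns} → Descending n ns → fibSum ns ≤ length ns * fib n
fibSum-bound [] = z≤n
fibSum-bound {ns = _ ∷ ns} (chain _ m≤n ns↓) =
  +-mono-≤ (fib-mono m≤n) (≤-trans (fibSum-bound ns↓) (*-monoʳ-≤ (length ns) (fib-mono m≤n)))

-- `search` pushes the largest index first, hence the reversal: the finished list increases, like
-- the tuples in `solutions`.
search-sound : ∀ k n {ms ns s} → Descending n ns → length ns ≡ k → fibSum ns ≡ s →
               search ms k s n ≡ true → isSolution (ns ʳ++ ms) ≡ true
search-sound zero n [] refl refl p = p
search-sound (suc k) zero (chain 1≤m m≤0 _) _ _ _ = contradiction (≤-trans 1≤m m≤0) λ ()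
search-sound (suc k) (suc n) {ms} {m ∷ ns} {s} ns↓@(chain 1≤m m≤1+n ms↓) len refl p =
  [ (λ { (s≤s m≤n) → search-sound (suc k) n (chain 1≤m m≤n ms↓) len refl (∧-elimʳ {(f ≤ᵇ s) ⇒ found} q) })
  , (λ { refl → search-sound k (suc n) ms↓ (suc-injective len)
       (sym (trans (cong (s ∸_) (fastFib≡fib (suc n))) (m+n∸m≡n (fib (suc n)) (fibSum ns))))
       (⇒-elim (from-T (≤⇒≤ᵇ (subst (_≤ s) (sym (fastFib≡fib (suc n))) (m≤m+n (fib (suc n)) (fibSum ns)))))
               (∧-elimˡ q)) })
  ]′ (m≤n⇒m<n∨m≡n m≤1+n)
  where
  f = fastFib (suc n)
  found = search (suc n ∷ ms) k (s ∸ f) (suc n)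
  bound : s ≤ suc k * f
  bound = subst (λ x → s ≤ suc k * x) (sym (fastFib≡fib (suc n)))
            (subst (λ l → s ≤ l * fib (suc n)) len (fibSum-bound ns↓))
  q = ⇒-elim (from-T (≤⇒≤ᵇ bound)) p

searches : allOf (λ a → search [] 5 (2 ^ a) 35) (upTo 24) ≡ true
searches = refl

small-power : ∀ {a ns} → a < 24 → Descending 35 ns → length ns ≡ 5 → fibSum ns ≡ 2 ^ a →
              isSolution (ns ʳ++ []) ≡ true
small-power {a} {ns} a<24 ns↓ len eq = search-sound 5 35 {[]} {ns} {2 ^ a} ns↓ len eq
  (allOf-∈ {f = λ a → search [] 5 (2 ^ a) 35} {a} {upTo 24} (∈-upTo⁺ a<24) searches)

index-bound : ∀ N {x n} → x < fastFib N → fib n ≤ x → n < N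
index-bound N {x} {n} x< fib≤ with n <? N
... | yes n<N = n<N
... | no  n≮N = contradiction
  (≤-trans (subst (x <_) (fastFib≡fib N) x<) (≤-trans (fib-mono (≮⇒≥ n≮N)) fib≤)) (n≮n x)

-- The largest sum, from `(6 , 10 , 14 , 16 , 20)`, is `2 ^ 13`.
solutions-sound : All (λ (n₅ , n₄ , n₃ , n₂ , n₁) →
  Any (λ a → 1 ≤ a × fib n₁ + fib n₂ + fib n₃ + fib n₄ + fib n₅ ≡ 2 ^ a) (upTo 14)) solutions
solutions-sound = does-sound (all? (λ _ → any? (λ a → (1 ≤? a) ×-dec (_ ≟ 2 ^ a)) (upTo 14)) solutions) refl

theorem1 : (n₁ n₂ n₃ n₄ n₅ : ℕ) →
    1 ≤ n₅ → n₁ ≥ n₂ → n₂ ≥ n₃ → n₃ ≥ n₄ → n₄ ≥ n₅ →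
    (∃[ a ] (1 ≤ a × fib n₁ + fib n₂ + fib n₃ + fib n₄ + fib n₅ ≡ 2 ^ a))
    ⇔ ((n₅ , n₄ , n₃ , n₂ , n₁) ∈ solutions)
theorem1 n₁ n₂ n₃ n₄ n₅ 1≤n₅ n₂≤n₁ n₃≤n₂ n₄≤n₃ n₅≤n₄ =
  mk⇔ (λ (a , _ , eq) → forward a eq) (λ n∈ → Any.satisfied (All.lookup solutions-sound n∈))
  where
  ns = n₁ ∷ n₂ ∷ n₃ ∷ n₄ ∷ n₅ ∷ []
  1≤n₄ = ≤-trans 1≤n₅ n₅≤n₄
  1≤n₃ = ≤-trans 1≤n₄ n₄≤n₃
  1≤n₂ = ≤-trans 1≤n₃ n₃≤n₂
  1≤n₁ = ≤-trans 1≤n₂ n₂≤n₁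

  sum≡ : ∀ {p} → fib n₁ + fib n₂ + fib n₃ + fib n₄ + fib n₅ ≡ p → fibSum ns ≡ p
  sum≡ = trans (solve 5 (λ v w x y z → v :+ (w :+ (x :+ (y :+ (z :+ con 0)))) := v :+ w :+ x :+ y :+ z) refl
                  (fib n₁) (fib n₂) (fib n₃) (fib n₄) (fib n₅))

  n₁≤35 : ∀ {a} → a < 24 → fibSum ns ≡ 2 ^ a → n₁ ≤ 35
  -- `fastFib 36` is 14930352, which exceeds `2 ^ 23`.
  n₁≤35 (s≤s a≤23) eq = ≤-pred (index-bound 36 (<ᵇ⇒< (2 ^ 23) (fastFib 36) _)
    (≤-trans (m≤m+n (fib n₁) _) (≤-trans (≤-reflexive eq) (^-monoʳ-≤ 2 a≤23))))

  forward : ∀ a → fib n₁ + fib n₂ + fib n₃ + fib n₄ + fib n₅ ≡ 2 ^ a → (n₅ , n₄ , n₃ , n₂ , n₁) ∈ solutions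
  forward a eq with a <? 24
  ... | no a≮24  = ⊥-elim (no-large-power (≮⇒≥ a≮24) ns refl (sum≡ eq))
  ... | yes a<24 = does-sound (_ ∈₅? solutions)
    (small-power a<24
      (chain 1≤n₁ (n₁≤35 a<24 (sum≡ eq))
        (chain 1≤n₂ n₂≤n₁ (chain 1≤n₃ n₃≤n₂ (chain 1≤n₄ n₄≤n₃ (chain 1≤n₅ n₅≤n₄ [])))))
      refl (sum≡ eq))
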